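{- Let $(S,K,I)$ be an active split graph such that $\Phi=\Phi(S)$ is simple and connected. Then exactly one of the following holds: (1) $\Phi$ is complete and $|K|=|I|$; (2) $|K|=\omega(\Phi)<|I|$, and every vertex of $\Phi$ belongs to some maximum clique of $\Phi$; in particular $|K|\le 1+\min\{\deg_{\Phi}(v): v\in I\}$.
   Context: All graphs are finite and simple. A split graph is a graph $S$ whose vertex set is a disjoint union $V(S)=K\,\dot\cup\,I$ with $K$ a clique and $I$ an independent set; $(K,I)$ is called a bipartition of $S$, and $(S,K,I)$ denotes $S$ together with this fixed bipartition. A 2-switch in a graph $G$ is performed on four distinct vertices $a,b,c,d$ with $ab,cd\in E(G)$ and $ac,bd\notin E(G)$: it deletes $ab,cd$ and adds $ac,bd$; $a,b,c,d$ are said to participate in it. A vertex is active in $G$ if it participates in some 2-switch on $G$; $G$ is active if all its vertices are active. For a split graph $(S,K,I)$ and distinct $u,v\in I$, $\sigma_{uv}(S)$ is the number of induced subgraphs of $S$ isomorphic to $P_4$ containing both $u$ and $v$. The factor graph $\Phi(S)$ is the loopless multigraph with vertex set $I$ having exactly $\sigma_{uv}(S)$ parallel edges between $u$ and $v$; it is simple if $\sigma_{uv}(S)\in\{0,1\}$ for all $u,v$. Graph notions (connected, complete, clique, clique number $\omega(\Phi)$, degree $\deg_\Phi$, etc.) applied to $\Phi(S)$ refer to its underlying simple graph, in which $u\sim v$ iff $\sigma_{uv}(S)\ge1$. -}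

module Defs where

open import Data.Bool.Base using (if_then_else_)
open import Data.Fin.Base using (Fin; zero; suc; toℕ)
import Data.Fin.Properties as Fin
open import Data.Fin.Subset
  using (Subset; inside; outside; _∈_; _⊆_; _∩_; _∪_; ∣_∣; Empty; ⊤)
open import Data.Fin.Subset.Properties using (_∈?_; _⊆?_; ∈⊤; x∈p∩q⁺)
open import Data.List.Base using (List; []; _∷_; _++_; map; filter; length; allFin)
open import Data.List.Extrema.Nat using (min; max)
open import Data.List.Properties using (filter-≐)
open import Data.Nat.Base using (ℕ; zero; suc; _≤_)
import Data.Nat.Properties as ℕ
open import Data.Product.Base using (∃; ∃-syntax; _×_; _,_; proj₁; proj₂; swap)
open import Data.Sum.Base as Sum using (_⊎_; inj₁; inj₂)
open import Data.Vec.Base using (Vec; []; _∷_; lookup; tabulate)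
open import Function.Base using (_∘_)
open import Function.Bundles using (_⇔_; mk⇔; Equivalence)
open import Level using (0ℓ)
open import Relation.Binary.Construct.Closure.ReflexiveTransitive using (Star)
open import Relation.Binary.Core using (Rel)
import Relation.Binary.Definitions as B
open import Relation.Binary.PropositionalEquality
  using (_≡_; _≢_; refl; sym; cong; subst)
open import Relation.Nullary using (¬_; Dec; yes; no; does)
open import Relation.Nullary.Decidable using (map′; _×-dec_; _⊎-dec_; _→-dec_; ¬?)
open import Relation.Unary using (Pred; Decidable)

private
  variable
    n : ℕ

ExactlyOne : Set → Set → Set
ExactlyOne A B = (A × ¬ B) ⊎ (¬ A × B)

-- The vertices are a subset of the labels `Fin n`, so that a graph, its induced
-- subgraphs and a graph on one side of its bipartition share their labels.
-- Adjacency is decidable: the graphs are those of classical finite graph theory.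
record Graph (n : ℕ) : Set₁ where
  field
    V          : Subset n
    _~_        : Rel (Fin n) 0ℓ
    _~?_       : B.Decidable _~_
    ~-sym      : B.Symmetric _~_
    ~-irrefl   : ∀ {x} → ¬ (x ~ x)
    ~-endpoint : ∀ {x y} → x ~ y → x ∈ V

-- Every subset of `Fin n`, each listed exactly once.
subsets : ∀ n → List (Subset n)
subsets zero    = [] ∷ []
subsets (suc n) = map (inside ∷_) (subsets n) ++ map (outside ∷_) (subsets n)

members : Subset n → List (Fin n)
members {n} p = filter (_∈? p) (allFin n)

module _ (G : Graph n) where
  open Graph G

  IsClique : Subset n → Set
  IsClique C = C ⊆ V × (∀ x y → x ∈ C → y ∈ C → x ≢ y → x ~ y)

  IsIndependent : Subset n → Set
  IsIndependent C = C ⊆ V × (∀ x y → x ∈ C → y ∈ C → ¬ (x ~ y))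

  isClique? : Decidable IsClique
  isClique? C = (C ⊆? V) ×-dec Fin.all? λ x → Fin.all? λ y →
    (x ∈? C) →-dec ((y ∈? C) →-dec (¬? (x Fin.≟ y) →-dec (x ~? y)))

  cliqueNumber : ℕ
  cliqueNumber = max 0 (map ∣_∣ (filter isClique? (subsets n)))

  IsMaximumClique : Subset n → Set
  IsMaximumClique C = IsClique C × (∀ D → IsClique D → ∣ D ∣ ≤ ∣ C ∣)

  IsComplete : Set
  IsComplete = IsClique V

  -- The graph without vertices counts as connected.
  IsConnected : Set
  IsConnected = ∀ x y → x ∈ V → y ∈ V → Star _~_ x y

  neighbours : Fin n → Subset n
  neighbours x = tabulate (λ y → does (x ~? y))

  degree : Fin n → ℕ
  degree x = ∣ neighbours x ∣

  -- Every degree is below `n`, so the default value `n` is returned only when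
  -- there is no vertex.
  minDegree : ℕ
  minDegree = min n (map degree (members V))

  record TwoSwitch (a b c d : Fin n) : Set where
    field
      a≢b : a ≢ b
      a≢c : a ≢ c
      a≢d : a ≢ d
      b≢c : b ≢ c
      b≢d : b ≢ d
      c≢d : c ≢ d
      ab∈E : a ~ b
      cd∈E : c ~ d
      ac∉E : ¬ (a ~ c)
      bd∉E : ¬ (b ~ d)

  IsActiveVertex : Fin n → Set
  IsActiveVertex x = ∃[ a ] ∃[ b ] ∃[ c ] ∃[ d ]
    TwoSwitch a b c d × (x ≡ a ⊎ x ≡ b ⊎ x ≡ c ⊎ x ≡ d)

  IsActive : Set
  IsActive = ∀ x → x ∈ V → IsActiveVertex x

  induced : Subset n → Graph n
  induced T = record
    { V          = V ∩ T
    ; _~_        = λ x y → x ~ y × x ∈ T × y ∈ T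
    ; _~?_       = λ x y → (x ~? y) ×-dec ((x ∈? T) ×-dec (y ∈? T))
    ; ~-sym      = λ { (e , p , q) → ~-sym e , q , p }
    ; ~-irrefl   = λ { (e , _) → ~-irrefl e }
    ; ~-endpoint = λ { (e , p , _) → x∈p∩q⁺ (~-endpoint e , p) }
    }

P₄ : Graph 4
P₄ = record
  { V          = ⊤
  ; _~_        = λ i j → suc (toℕ i) ≡ toℕ j ⊎ suc (toℕ j) ≡ toℕ i
  ; _~?_       = λ i j → (suc (toℕ i) ℕ.≟ toℕ j) ⊎-dec (suc (toℕ j) ℕ.≟ toℕ i)
  ; ~-sym      = Sum.swap
  ; ~-irrefl   = λ { (inj₁ e) → ℕ.1+n≢n e ; (inj₂ e) → ℕ.1+n≢n e }
  ; ~-endpoint = λ _ → ∈⊤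
  }

module _ (H : Graph n) where
  private
    module P = Graph P₄
    module H = Graph H

  -- An isomorphism P₄ → H, given by the vector of images of the vertices of P₄,
  -- which makes the existence of one decidable by exhaustive search.
  record IsIsoFromP₄ (f : Vec (Fin n) 4) : Set where
    field
      into      : ∀ i → lookup f i ∈ H.V
      injective : ∀ i j → lookup f i ≡ lookup f j → i ≡ j
      onto      : ∀ x → x ∈ H.V → ∃[ i ] lookup f i ≡ x
      edges     : ∀ i j → (i P.~ j) ⇔ (lookup f i H.~ lookup f j)

  IsomorphicToP₄ : Set
  IsomorphicToP₄ = ∃ IsIsoFromP₄

  isIsoFromP₄? : Decidable IsIsoFromP₄
  isIsoFromP₄? f = map′
    (λ { (p , q , r , s) → record
      { into = p ; injective = q ; onto = r
      ; edges = λ i j → mk⇔ (proj₁ (s i j)) (proj₂ (s i j)) } })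
    (λ φ → let open IsIsoFromP₄ φ in into , injective , onto
      , λ i j → Equivalence.to (edges i j) , Equivalence.from (edges i j))
    (Fin.all? (λ i → lookup f i ∈? H.V)
      ×-dec Fin.all? (λ i → Fin.all? λ j →
              (lookup f i Fin.≟ lookup f j) →-dec (i Fin.≟ j))
      ×-dec Fin.all? (λ x → (x ∈? H.V) →-dec Fin.any? λ i → lookup f i Fin.≟ x)
      ×-dec Fin.all? (λ i → Fin.all? λ j →
              ((i P.~? j) →-dec (lookup f i H.~? lookup f j))
                ×-dec ((lookup f i H.~? lookup f j) →-dec (i P.~? j))))

anyVec? : ∀ {m} {Q : Pred (Vec (Fin n) m) 0ℓ} → Decidable Q → Dec (∃ Q)
anyVec? {m = zero}  Q? = map′ ([] ,_) (λ { ([] , q) → q }) (Q? [])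
anyVec? {m = suc m} Q? = map′
  (λ { (x , xs , q) → x ∷ xs , q })
  (λ { (x ∷ xs , q) → x , xs , q })
  (Fin.any? λ x → anyVec? λ xs → Q? (x ∷ xs))

module _ (G : Graph n) where
  open Graph G

  -- An induced subgraph is determined by its vertex set.
  InducesP₄ : Fin n → Fin n → Subset n → Set
  InducesP₄ u v T = T ⊆ V × (u ∈ T × v ∈ T) × IsomorphicToP₄ (induced G T)

  inducesP₄? : ∀ u v → Decidable (InducesP₄ u v)
  inducesP₄? u v T = (T ⊆? V) ×-dec (((u ∈? T) ×-dec (v ∈? T))
    ×-dec anyVec? (isIsoFromP₄? (induced G T)))

  σ : Fin n → Fin n → ℕ
  σ u v = length (filter (inducesP₄? u v) (subsets n))

  σ-sym : ∀ u v → σ u v ≡ σ v u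
  σ-sym u v = cong length (filter-≐ (inducesP₄? u v) (inducesP₄? v u)
    (flipped , flipped) (subsets n))
    where
    flipped : ∀ {x y T} → InducesP₄ x y T → InducesP₄ y x T
    flipped (p , q , r) = p , swap q , r

-- Loopless multigraphs; `mult x y` is the number of parallel edges joining x and y.
record Multigraph (n : ℕ) : Set where
  field
    V             : Subset n
    mult          : Fin n → Fin n → ℕ
    mult-sym      : ∀ x y → mult x y ≡ mult y x
    mult-loopless : ∀ x → mult x x ≡ 0
    mult-endpoint : ∀ {x y} → 1 ≤ mult x y → x ∈ V

IsSimple : Multigraph n → Set
IsSimple M = ∀ x y → mult x y ≡ 0 ⊎ mult x y ≡ 1
  where open Multigraph M

underlying : Multigraph n → Graph n
underlying M = record
  { V          = V
  ; _~_        = λ x y → 1 ≤ mult x y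
  ; _~?_       = λ x y → 1 ℕ.≤? mult x y
  ; ~-sym      = λ {x} {y} → subst (1 ≤_) (mult-sym x y)
  ; ~-irrefl   = λ {x} p → ℕ.1+n≰n (subst (1 ≤_) (mult-loopless x) p)
  ; ~-endpoint = mult-endpoint
  }
  where open Multigraph M

record SplitGraph (n : ℕ) : Set₁ where
  field
    S             : Graph n
    K I           : Subset n
    partition     : K ∪ I ≡ Graph.V S
    disjoint      : Empty (K ∩ I)
    K-clique      : IsClique S K
    I-independent : IsIndependent S I

module _ {A : Set} where

  when : Dec A → ℕ → ℕ
  when a? k = if does a? then k else 0

  when-no : (a? : Dec A) (k : ℕ) → ¬ A → when a? k ≡ 0
  when-no (yes a) k ¬a with () ← ¬a a
  when-no (no _)  k _  = refl

  when-positive : (a? : Dec A) (k : ℕ) → 1 ≤ when a? k → A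
  when-positive (yes a) k _ = a

when-cong : {A B : Set} (a? : Dec A) (b? : Dec B) {k l : ℕ} →
            (A → B) → (B → A) → k ≡ l → when a? k ≡ when b? l
when-cong (yes _) (yes _) _ _ k≡l = k≡l
when-cong (yes a) (no ¬b) f _ _ with () ← ¬b (f a)
when-cong (no ¬a) (yes b) _ g _ with () ← ¬a (g b)
when-cong (no _)  (no _)  _ _ _ = refl

Distinct∈ : Subset n → Fin n → Fin n → Set
Distinct∈ I x y = x ≢ y × x ∈ I × y ∈ I

distinct∈? : (I : Subset n) → B.Decidable (Distinct∈ I)
distinct∈? I x y = ¬? (x Fin.≟ y) ×-dec ((x ∈? I) ×-dec (y ∈? I))

distinct∈-sym : (I : Subset n) → B.Symmetric (Distinct∈ I)
distinct∈-sym I (x≢y , p , q) = (x≢y ∘ sym) , q , p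

factorGraph : SplitGraph n → Multigraph n
factorGraph X = record
  { V             = I
  ; mult          = λ x y → when (distinct∈? I x y) (σ S x y)
  ; mult-sym      = λ x y → when-cong (distinct∈? I x y) (distinct∈? I y x)
                      (distinct∈-sym I) (distinct∈-sym I) (σ-sym S x y)
  ; mult-loopless = λ x → when-no (distinct∈? I x x) (σ S x x) (λ d → proj₁ d refl)
  ; mult-endpoint = λ {x} {y} p →
                      proj₁ (proj₂ (when-positive (distinct∈? I x y) (σ S x y) p))
  }
  where open SplitGraph X

-- For u, v ∈ I, an induced P₄ through u and v amounts to a choice of k ∈ N(u) ∖ N(v) and
-- l ∈ N(v) ∖ N(u). If Φ is simple, adjacent vertices of Φ therefore have neighbourhoods
-- differing by a single exchange; if Φ is connected, all neighbourhoods then have the same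
-- size, so distinct ones are Φ-adjacent. Thus the neighbourhoods form a clique in a Johnson
-- graph, which is a sunflower with a common kernel or a family of sets co-singleton in a
-- common set. Activity makes the kernel empty, respectively the common set equal to K, so
-- each u ∈ I has exactly one neighbour in K, or each has exactly one non-neighbour. That
-- vertex of K labels the part of u in Φ, which is complete multipartite with ∣ K ∣ parts.

module Submission where

open import Defs
open import Data.Nat.Base using (ℕ; _+_; _≤_; _<_)
open import Data.Fin.Subset using (_∈_; ∣_∣)
open import Data.Product.Base using (_×_; ∃-syntax)
open import Relation.Binary.PropositionalEquality using (_≡_)

open import Data.Empty using (⊥-elim)
open import Data.Fin.Base using (Fin; zero; suc)
open import Data.Fin.Patterns using (0F; 1F; 2F; 3F)
open import Data.Fin.Properties using (_≟_; any?; suc-injective)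
open import Data.Fin.Subset using (Subset; inside; outside; _⊆_; _-_)
open import Data.Fin.Subset.Properties
  using (_∈?_; nonempty?; x∈p∪q⁻; x∈p∪q⁺; x∈p∩q⁺; x∈p∩q⁻; p─⊥≡p; p⊆q⇒∣p∣≤∣q∣; p⊂q⇒∣p∣<∣q∣; ∣p∣≤n;
         x∈p⇒∣p-x∣<∣p∣; x∈p∧x≢y⇒x∈p-y; p─q⊆p)
open import Data.List.Base using (List; []; _∷_; length; map; filter; allFin)
open import Data.List.Extrema.Nat using (max≤v⁺; v≤max⁺; v≤min⁺)
open import Data.List.Membership.Propositional using () renaming (_∈_ to _∈ₗ_)
open import Data.List.Membership.Propositional.Properties using (∈-map⁺; ∈-++⁺ˡ; ∈-++⁺ʳ; ∈-filter⁺; ∈-filter⁻)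
import Data.List.Relation.Unary.All as All
import Data.List.Relation.Unary.All.Properties as All
open import Data.List.Relation.Unary.Any as Any using (here)
open import Data.Nat.Base using (suc; pred; z≤n; s≤s)
import Data.Nat.Properties as ℕ
open import Data.Product.Base using (∃; _,_; proj₁; proj₂)
open import Data.Sum.Base using (_⊎_; inj₁; inj₂; [_,_])
open import Data.Vec.Base as Vec using (Vec; []; _∷_; lookup; tabulate)
open import Data.Vec.Properties using ([]=⇒lookup; lookup⇒[]=; lookup∘tabulate)
open import Function.Base using (_∘_; id; case_of_)
open import Function.Bundles using (mk⇔; Equivalence)
open import Relation.Binary.Construct.Closure.ReflexiveTransitive using (Star; ε; _◅_)
open import Relation.Binary.Definitions using () renaming (Decidable to Decidable₂)
open import Relation.Binary.PropositionalEquality using (_≢_; refl; sym; trans; cong; subst)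
open import Relation.Nullary using (¬_; Dec; yes; no; does; contradiction)
open import Relation.Nullary.Decidable using (¬?; _×-dec_; decidable-stable; dec-true; from-no)

private
  variable
    m n : ℕ

-- Finite sets

module _ {P : Fin n → Set} (P? : ∀ x → Dec (P x)) where

  ∈-tabulate-does⁺ : ∀ {x} → P x → x ∈ tabulate (does ∘ P?)
  ∈-tabulate-does⁺ {x} px =
    lookup⇒[]= x _ (trans (lookup∘tabulate (does ∘ P?) x) (dec-true (P? x) px))

  ∈-tabulate-does⁻ : ∀ {x} → x ∈ tabulate (does ∘ P?) → P x
  ∈-tabulate-does⁻ {x} x∈ with P? x | trans (sym (lookup∘tabulate (does ∘ P?) x)) ([]=⇒lookup x∈)
  ... | yes px | _ = px
  ... | no  _  | ()

-- Injectivity is asked on `p` alone, since `part` is known to be injective on cliques and `section`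
-- on `K`. Each element taken from `p` has its image deleted from `q`.
injection⇒∣p∣≤∣q∣ : (f : Fin m → Fin n) (p : Subset m) (q : Subset n) →
  (∀ {x} → x ∈ p → f x ∈ q) →
  (∀ {x y} → x ∈ p → y ∈ p → f x ≡ f y → x ≡ y) →
  ∣ p ∣ ≤ ∣ q ∣
injection⇒∣p∣≤∣q∣ f []            q maps inj = z≤n
injection⇒∣p∣≤∣q∣ f (outside ∷ p) q maps inj =
  injection⇒∣p∣≤∣q∣ (f ∘ suc) p q (maps ∘ Vec.there)
    (λ x∈p y∈p → suc-injective ∘ inj (Vec.there x∈p) (Vec.there y∈p))
injection⇒∣p∣≤∣q∣ f (inside ∷ p)  q maps inj =
  ℕ.≤-trans (s≤s rest) (x∈p⇒∣p-x∣<∣p∣ (maps Vec.here))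
  where
  rest : ∣ p ∣ ≤ ∣ q - f zero ∣
  rest = injection⇒∣p∣≤∣q∣ (f ∘ suc) p (q - f zero)
    (λ x∈p → x∈p∧x≢y⇒x∈p-y (maps (Vec.there x∈p))
      (λ eq → case inj (Vec.there x∈p) Vec.here eq of λ ()))
    (λ x∈p y∈p → suc-injective ∘ inj (Vec.there x∈p) (Vec.there y∈p))

∣p∣≤1+∣p-x∣ : (p : Subset n) (x : Fin n) → ∣ p ∣ ≤ 1 + ∣ p - x ∣
-- Deleting position `zero` leaves `p ─ ⊥` as the tail.
∣p∣≤1+∣p-x∣ (inside  ∷ p) zero    = s≤s (ℕ.≤-reflexive (cong ∣_∣ (sym (p─⊥≡p p))))
∣p∣≤1+∣p-x∣ (outside ∷ p) zero    = ℕ.m≤n⇒m≤1+n (ℕ.≤-reflexive (cong ∣_∣ (sym (p─⊥≡p p))))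
∣p∣≤1+∣p-x∣ (inside  ∷ p) (suc x) = s≤s (∣p∣≤1+∣p-x∣ p x)
∣p∣≤1+∣p-x∣ (outside ∷ p) (suc x) = ∣p∣≤1+∣p-x∣ p x

x∉p-x : (p : Subset n) {x : Fin n} → ¬ (x ∈ p - x)
x∉p-x (_ ∷ p) {zero}  ()
x∉p-x (_ ∷ p) {suc x} (Vec.there x∈) = x∉p-x p x∈

p⊆q∧∣q∣≤∣p∣⇒q⊆p : {p q : Subset n} → p ⊆ q → ∣ q ∣ ≤ ∣ p ∣ → q ⊆ p
p⊆q∧∣q∣≤∣p∣⇒q⊆p {p = p} p⊆q ∣q∣≤∣p∣ {x} x∈q = decidable-stable (x ∈? p) λ x∉p →
  ℕ.<⇒≱ (p⊂q⇒∣p∣<∣q∣ (p⊆q , x , x∈q , x∉p)) ∣q∣≤∣p∣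

-- Without such a `y`, `q` would be a proper subset of `p`.
∣p∣≤∣q∣-exchange : {p q : Subset n} → ∣ p ∣ ≤ ∣ q ∣ → ∀ {x} → x ∈ p → ¬ (x ∈ q) →
  ∃[ y ] (y ∈ q × ¬ (y ∈ p))
∣p∣≤∣q∣-exchange {p = p} {q} ∣p∣≤∣q∣ {x} x∈p x∉q
  with any? (λ y → (y ∈? q) ×-dec ¬? (y ∈? p))
... | yes found = found
... | no none   = contradiction ∣p∣≤∣q∣ (ℕ.<⇒≱ (p⊂q⇒∣p∣<∣q∣ (q⊆p , x , x∈p , x∉q)))
  where
  q⊆p : q ⊆ p
  q⊆p {y} y∈q = decidable-stable (y ∈? p) λ y∉p → none (y , y∈q , y∉p)

-- The set `p - x` is a proper subset of `q`, and the strict inequality makes up for the deleted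
-- element.
exchange⇒∣p∣≤∣q∣ : {p q : Subset n} {x y : Fin n} →
  (∀ {z} → z ∈ p → ¬ (z ∈ q) → z ≡ x) → y ∈ q → ¬ (y ∈ p) → ∣ p ∣ ≤ ∣ q ∣
exchange⇒∣p∣≤∣q∣ {p = p} {q} {x} {y} only y∈q y∉p =
  ℕ.≤-trans (∣p∣≤1+∣p-x∣ p x) (p⊂q⇒∣p∣<∣q∣ (p-x⊆q , y , y∈q , y∉p ∘ p─q⊆p p _))
  where
  p-x⊆q : p - x ⊆ q
  p-x⊆q {z} z∈ = decidable-stable (z ∈? q) λ z∉q →
    x∉p-x p (subst (_∈ p - x) (only (p─q⊆p p _ z∈) z∉q) z∈)

choice : (p : Subset n) {Q : Fin n → Fin n → Set} →
  (∀ x → x ∈ p → ∃ (Q x)) → ∃[ f ] (∀ x → x ∈ p → Q x (f x))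
choice p {Q} total = proj₁ ∘ chosen , λ x → proj₂ (chosen x)
  where
  chosen : ∀ x → ∃[ y ] (x ∈ p → Q x y)
  chosen x with x ∈? p
  ... | yes x∈p = let y , q = total x x∈p in y , λ _ → q
  -- Nothing is required of the value outside `p`, so `x` itself serves.
  ... | no  x∉p = x , λ x∈p → contradiction x∈p x∉p

∈-subsets : (p : Subset n) → p ∈ₗ subsets n
∈-subsets []            = here refl
∈-subsets (inside  ∷ p) = ∈-++⁺ˡ (∈-map⁺ (inside ∷_) (∈-subsets p))
∈-subsets (outside ∷ p) =
  ∈-++⁺ʳ (map (inside ∷_) (subsets _)) (∈-map⁺ (outside ∷_) (∈-subsets p))

module _ {A : Set} where

  length>0⇒∃∈ : (xs : List A) → 1 ≤ length xs → ∃[ x ] (x ∈ₗ xs)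
  length>0⇒∃∈ (x ∷ xs) _ = x , here refl

  ∈⇒length>0 : ∀ {x} {xs : List A} → x ∈ₗ xs → 1 ≤ length xs
  ∈⇒length>0 {xs = _ ∷ _} _ = s≤s z≤n

  length≤1⇒∈-unique : ∀ {x y} (xs : List A) → length xs ≤ 1 → x ∈ₗ xs → y ∈ₗ xs → x ≡ y
  length≤1⇒∈-unique (_ ∷ [])    _        (here refl) (here refl) = refl
  length≤1⇒∈-unique (_ ∷ _ ∷ _) (s≤s ()) _           _

image : Vec (Fin n) m → Subset n
image f = tabulate (λ x → does (any? (λ i → lookup f i ≟ x)))

module _ (f : Vec (Fin n) m) where

  ∈-image⁺ : ∀ {x} i → lookup f i ≡ x → x ∈ image f
  ∈-image⁺ i eq = ∈-tabulate-does⁺ (λ x → any? (λ i → lookup f i ≟ x)) (i , eq)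

  ∈-image⁻ : ∀ {x} → x ∈ image f → ∃[ i ] lookup f i ≡ x
  ∈-image⁻ = ∈-tabulate-does⁻ (λ x → any? (λ i → lookup f i ≟ x))

-- Complete multipartite graphs

module _ (G : Graph n) where
  open Graph G

  cliqueNumber-unique : ∀ {C} → IsMaximumClique G C → cliqueNumber G ≡ ∣ C ∣
  cliqueNumber-unique {C} (isC , maximal) = ℕ.≤-antisym
    (max≤v⁺ z≤n (All.map⁺ (All.tabulate
      (maximal _ ∘ proj₂ ∘ ∈-filter⁻ (isClique? G) {xs = subsets n}))))
    (v≤max⁺ 0 _ (inj₂ (Any.map ℕ.≤-reflexive
      (∈-map⁺ ∣_∣ (∈-filter⁺ (isClique? G) (∈-subsets C) isC)))))

  clique≤1+degree : ∀ {C v} → IsClique G C → v ∈ C → ∣ C ∣ ≤ 1 + degree G v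
  clique≤1+degree {C} {v} (_ , adjacent) v∈C =
    ℕ.≤-trans (∣p∣≤1+∣p-x∣ C v) (s≤s (p⊆q⇒∣p∣≤∣q∣ λ x∈C-v →
      ∈-tabulate-does⁺ (v ~?_) (adjacent _ _ v∈C (p─q⊆p C _ x∈C-v) λ { refl → x∉p-x C x∈C-v })))

  -- The minimum has default value `n`, so `k ≤ n` is what covers a graph without vertices. Passing
  -- to `pred k` turns the claim into a lower bound on each entry of the list.
  ≤1+minDegree : ∀ {k} → k ≤ n → (∀ v → v ∈ V → k ≤ 1 + degree G v) → k ≤ 1 + minDegree G
  ≤1+minDegree {k} k≤n bound = pred≤⇒≤suc (v≤min⁺ (ℕ.≤⇒pred≤ k≤n)
    (All.map⁺ (All.tabulate λ {v} v∈ → ℕ.pred-mono-≤ (bound v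
      (proj₂ (∈-filter⁻ (_∈? V) {xs = allFin n} v∈))))))
    where
    pred≤⇒≤suc : ∀ {k l} → pred k ≤ l → k ≤ 1 + l
    pred≤⇒≤suc {ℕ.zero} _ = z≤n
    pred≤⇒≤suc {suc k} p = s≤s p

-- Presents `G` as complete multipartite, its parts nonempty and labelled by the elements of `K`.
-- Values of `part` outside `V` are harmless, because edges end in `V`.
record PartMap (G : Graph n) (K : Subset n) : Set where
  open Graph G
  field
    part         : Fin n → Fin n
    part∈K       : ∀ x → x ∈ V → part x ∈ K
    part-onto    : ∀ k → k ∈ K → ∃[ x ] (x ∈ V × part x ≡ k)
    part-≢⇒~     : ∀ {x y} → x ∈ V → y ∈ V → part x ≢ part y → x ~ y
    part-≡⇒≁     : ∀ {x y} → part x ≡ part y → ¬ (x ~ y)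

module CompleteMultipartite {G : Graph n} {K : Subset n} (parts : PartMap G K) where
  open Graph G
  open PartMap parts

  part-injective-on-clique : ∀ {C} → IsClique G C →
    ∀ {x y} → x ∈ C → y ∈ C → part x ≡ part y → x ≡ y
  part-injective-on-clique (_ , adjacent) {x} {y} x∈C y∈C eq =
    decidable-stable (x ≟ y) λ x≢y → part-≡⇒≁ eq (adjacent x y x∈C y∈C x≢y)

  -- A clique meets each part at most once.
  ∣clique∣≤∣K∣ : ∀ C → IsClique G C → ∣ C ∣ ≤ ∣ K ∣
  ∣clique∣≤∣K∣ C isC@(C⊆V , _) =
    injection⇒∣p∣≤∣q∣ part C K (part∈K _ ∘ C⊆V) (part-injective-on-clique isC)

  record Section : Set where
    field
      section      : Fin n → Fin n
      section∈V    : ∀ k → k ∈ K → section k ∈ V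
      part-section : ∀ k → k ∈ K → part (section k) ≡ k

  module _ (s : Section) where
    open Section s

    private
      isRepresentative? : ∀ x → Dec (x ∈ V × section (part x) ≡ x)
      isRepresentative? x = (x ∈? V) ×-dec (section (part x) ≟ x)

    -- This is the image of `K` under `section`. Describing it by fixed points makes membership
    -- decidable and recovers a member from its part.
    transversal : Subset n
    transversal = tabulate (does ∘ isRepresentative?)

    transversal⊆V : transversal ⊆ V
    transversal⊆V = proj₁ ∘ ∈-tabulate-does⁻ isRepresentative?

    ∈-transversal : ∀ {x} → x ∈ V → section (part x) ≡ x → x ∈ transversal
    ∈-transversal x∈V eq = ∈-tabulate-does⁺ isRepresentative? (x∈V , eq)

    transversal-isClique : IsClique G transversal
    transversal-isClique = transversal⊆V , λ x y x∈T y∈T x≢y →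
      let x∈V , sx = ∈-tabulate-does⁻ isRepresentative? x∈T
          y∈V , sy = ∈-tabulate-does⁻ isRepresentative? y∈T
      in part-≢⇒~ x∈V y∈V λ eq → x≢y (trans (sym sx) (trans (cong section eq) sy))

    ∣K∣≤∣transversal∣ : ∣ K ∣ ≤ ∣ transversal ∣
    ∣K∣≤∣transversal∣ = injection⇒∣p∣≤∣q∣ section K transversal
      (λ k∈K → ∈-transversal (section∈V _ k∈K) (cong section (part-section _ k∈K)))
      (λ k∈K l∈K eq →
        trans (sym (part-section _ k∈K)) (trans (cong part eq) (part-section _ l∈K)))

    transversal-isMaximum : IsMaximumClique G transversal
    transversal-isMaximum = transversal-isClique ,
      λ C isC → ℕ.≤-trans (∣clique∣≤∣K∣ C isC) ∣K∣≤∣transversal∣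

    ∣K∣≡∣transversal∣ : ∣ K ∣ ≡ ∣ transversal ∣
    ∣K∣≡∣transversal∣ =
      ℕ.≤-antisym ∣K∣≤∣transversal∣ (∣clique∣≤∣K∣ transversal transversal-isClique)

    -- The transversal is then as large as `V`, so `V` is that clique.
    ∣V∣≤∣K∣⇒complete : ∣ V ∣ ≤ ∣ K ∣ → IsComplete G
    ∣V∣≤∣K∣⇒complete ∣V∣≤∣K∣ = id , λ x y x∈V y∈V →
      proj₂ transversal-isClique x y (V⊆T x∈V) (V⊆T y∈V)
      where
      V⊆T : V ⊆ transversal
      V⊆T = p⊆q∧∣q∣≤∣p∣⇒q⊆p transversal⊆V (ℕ.≤-trans ∣V∣≤∣K∣ ∣K∣≤∣transversal∣)

  someSection : Section
  someSection = let s , correct = choice K part-onto in record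
    { section      = s
    ; section∈V    = λ k → proj₁ ∘ correct k
    ; part-section = λ k → proj₂ ∘ correct k
    }

  -- Redirecting `someSection` to `v` on the part of `v` puts `v` on a transversal, hence in a
  -- maximum clique.
  sectionThrough : ∀ v → v ∈ V → ∃[ s ] (Section.section s (part v) ≡ v)
  sectionThrough v v∈V = record
      { section      = λ k → proj₁ (point k)
      ; section∈V    = λ k → proj₁ ∘ proj₁ (proj₂ (point k))
      ; part-section = λ k → proj₂ ∘ proj₁ (proj₂ (point k))
      } , proj₂ (proj₂ (point (part v))) refl
    where
    open Section someSection
    -- The second condition carries the redirection along, so that it can be read off at `part v`
    -- afterwards.
    point : ∀ k → ∃[ x ] ((k ∈ K → x ∈ V × part x ≡ k) × (k ≡ part v → x ≡ v))
    point k with k ≟ part v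
    ... | yes refl = v , (λ _ → v∈V , refl) , λ _ → refl
    ... | no  k≢   = section k , (λ k∈K → section∈V k k∈K , part-section k k∈K)
                   , λ k≡ → contradiction k≡ k≢

  -- Cliques have at most `∣ K ∣` vertices and transversals exactly `∣ K ∣`, so `∣ V ∣` exceeds
  -- `∣ K ∣` precisely when `G` is not complete.
  dichotomy : ExactlyOne
    (IsComplete G × ∣ K ∣ ≡ ∣ V ∣)
    (∣ K ∣ ≡ cliqueNumber G × ∣ K ∣ < ∣ V ∣
      × (∀ v → v ∈ V → ∃[ C ] (IsMaximumClique G C × v ∈ C))
      × ∣ K ∣ ≤ 1 + minDegree G)
  dichotomy with isClique? G V
  ... | yes complete = inj₁ ((complete , ∣K∣≡∣V∣) , λ (_ , ∣K∣<∣V∣ , _) → ℕ.<-irrefl ∣K∣≡∣V∣ ∣K∣<∣V∣)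
    where
    ∣K∣≡∣V∣ : ∣ K ∣ ≡ ∣ V ∣
    ∣K∣≡∣V∣ = ℕ.≤-antisym
      (ℕ.≤-trans (∣K∣≤∣transversal∣ someSection) (p⊆q⇒∣p∣≤∣q∣ (transversal⊆V someSection)))
      (∣clique∣≤∣K∣ V complete)
  ... | no incomplete = inj₂ ((λ (complete , _) → incomplete complete)
    , trans (∣K∣≡∣transversal∣ someSection)
        (sym (cliqueNumber-unique G (transversal-isMaximum someSection)))
    , ℕ.≰⇒> (incomplete ∘ ∣V∣≤∣K∣⇒complete someSection)
    , (λ v v∈V → let s , sv = sectionThrough v v∈V in
        transversal s , transversal-isMaximum s , ∈-transversal s v∈V sv)
    , ≤1+minDegree G (∣p∣≤n K) λ v v∈V → let s , sv = sectionThrough v v∈V in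
        subst (_≤ 1 + degree G v) (sym (∣K∣≡∣transversal∣ s))
          (clique≤1+degree G (transversal-isClique s) (∈-transversal s v∈V sv)))

-- Families of sets differing by single exchanges

-- The sets { k ∈ K ∣ R u k } form a clique in a Johnson graph, possibly with
-- repetitions: vertices carrying the same set are the non-adjacent ones.
record ExchangeFamily (G : Graph n) (K : Subset n) (R : Fin n → Fin n → Set) : Set where
  open Graph G
  field
    R?       : Decidable₂ R
    covers   : ∀ {k} → k ∈ K → ∃[ u ] (u ∈ V × R u k)
    misses   : ∀ {k} → k ∈ K → ∃[ u ] (u ∈ V × ¬ R u k)
    exchange : ∀ {u v k} → u ∈ V → v ∈ V → k ∈ K → R u k → ¬ R v k →
               ∃[ l ] (l ∈ K × R v l × ¬ R u l)
    differ-once : ∀ {u v k l} → u ∈ V → v ∈ V → k ∈ K → l ∈ K →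
                  R u k → ¬ R v k → R u l → ¬ R v l → k ≡ l
    differ⇒~ : ∀ {u v k} → u ∈ V → v ∈ V → k ∈ K → R u k → ¬ R v k → u ~ v
    ~⇒differ : ∀ {u v} → u ~ v → ∃[ k ] (k ∈ K × R u k × ¬ R v k)

module _ {G : Graph n} {K : Subset n} {R : Fin n → Fin n → Set} (F : ExchangeFamily G K R) where
  open Graph G
  open ExchangeFamily F

  -- Complementing within `K` reverses each difference of two sets, so every axiom passes over with
  -- `u` and `v` swapped. Co-singleton sets thereby reduce to singletons.
  complement : ExchangeFamily G K (λ u k → ¬ R u k)
  complement = record
    { R?          = λ u k → ¬? (R? u k)
    ; covers      = misses
    ; misses      = λ k∈K → let u , u∈V , r = covers k∈K in u , u∈V , λ ¬r → ¬r r
    ; exchange    = λ u∈V v∈V k∈K ¬uk ¬¬vk →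
        let l , l∈K , ul , ¬vl = exchange v∈V u∈V k∈K (stable ¬¬vk) ¬uk
        in l , l∈K , ¬vl , λ ¬ul → ¬ul ul
    ; differ-once = λ u∈V v∈V k∈K l∈K ¬uk ¬¬vk ¬ul ¬¬vl →
        differ-once v∈V u∈V k∈K l∈K (stable ¬¬vk) ¬uk (stable ¬¬vl) ¬ul
    ; differ⇒~    = λ u∈V v∈V k∈K ¬uk ¬¬vk → ~-sym (differ⇒~ v∈V u∈V k∈K (stable ¬¬vk) ¬uk)
    ; ~⇒differ    = λ u~v → let k , k∈K , vk , ¬uk = ~⇒differ (~-sym u~v)
                            in k , k∈K , ¬uk , λ ¬vk → ¬vk vk
    }
    where
    stable : ∀ {u k} → ¬ ¬ R u k → R u k
    stable = decidable-stable (R? _ _)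

Unique : Subset n → (Fin n → Set) → Fin n → Set
Unique K P k = k ∈ K × P k × (∀ {l} → l ∈ K → P l → l ≡ k)

module _ {G : Graph n} {K : Subset n} {R : Fin n → Fin n → Set} (F : ExchangeFamily G K R) where
  open Graph G
  open ExchangeFamily F

  -- If `v` has `k`, any further element of its set would have to be exchanged for an element of `u`
  -- that `v` lacks, but `k` is the only candidate. If `v` lacks `k`, its whole set lies outside
  -- that of `u`, and `differ-once` leaves one element.
  unique-spreads : ∀ {u k} → u ∈ V → Unique K (R u) k → ∀ v → v ∈ V → ∃ (Unique K (R v))
  unique-spreads {u} {k} u∈V (k∈K , uk , only) v v∈V with R? v k
  ... | yes vk = k , k∈K , vk , λ {l} l∈K vl → only l∈K (decidable-stable (R? u l) λ ¬ul →
          let j , j∈K , uj , ¬vj = exchange v∈V u∈V l∈K vl ¬ul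
          in ¬vj (subst (R v) (sym (only j∈K uj)) vk))
  ... | no ¬vk =
    let l , l∈K , vl , ¬ul = exchange u∈V v∈V k∈K uk ¬vk
    in l , l∈K , vl , λ {j} j∈K vj → differ-once v∈V u∈V j∈K l∈K vj
         (λ uj → ¬vk (subst (R v) (only j∈K uj) vj)) vl ¬ul

  -- u and v differ by exchanging k for l; a further neighbour k′ and non-neighbour l′
  -- of u are then shared with v, and a vertex missing k′ and one meeting l′ differ in
  -- both k and l.
  unique-or-co-unique : ∀ {u} → u ∈ V → ∃[ k ] (k ∈ K × R u k) →
    ∃ (Unique K (R u)) ⊎ ∃ (Unique K (λ k → ¬ R u k))
  unique-or-co-unique {u} u∈V (k , k∈K , uk)
    with v , v∈V , ¬vk ← misses k∈K
    with l , l∈K , vl , ¬ul ← exchange u∈V v∈V k∈K uk ¬vk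
    with any? (λ k′ → (k′ ∈? K) ×-dec (R? u k′ ×-dec ¬? (k′ ≟ k)))
       | any? (λ l′ → (l′ ∈? K) ×-dec (¬? (R? u l′) ×-dec ¬? (l′ ≟ l)))
  ... | no none | _ = inj₁ (k , k∈K , uk , λ j∈K uj →
          decidable-stable (_ ≟ k) λ j≢k → none (_ , j∈K , uj , j≢k))
  ... | yes _ | no none = inj₂ (l , l∈K , ¬ul , λ j∈K ¬uj →
          decidable-stable (_ ≟ l) λ j≢l → none (_ , j∈K , ¬uj , j≢l))
  ... | yes (k′ , k′∈K , uk′ , k′≢k) | yes (l′ , l′∈K , ¬ul′ , l′≢l) =
    ⊥-elim (¬ul (subst (R u) (differ-once w∈V z∈V k∈K l∈K wk ¬zk wl ¬zl) uk))
    where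
    vk′ : R v k′
    vk′ = decidable-stable (R? v k′) λ ¬vk′ →
      k′≢k (differ-once u∈V v∈V k′∈K k∈K uk′ ¬vk′ uk ¬vk)

    ¬vl′ : ¬ R v l′
    ¬vl′ vl′ = l′≢l (differ-once v∈V u∈V l′∈K l∈K vl′ ¬ul′ vl ¬ul)

    w = proj₁ (misses k′∈K)
    w∈V = proj₁ (proj₂ (misses k′∈K))
    ¬wk′ = proj₂ (proj₂ (misses k′∈K))
    z = proj₁ (covers l′∈K)
    z∈V = proj₁ (proj₂ (covers l′∈K))
    zl′ = proj₂ (proj₂ (covers l′∈K))

    wk : R w k
    wk = decidable-stable (R? w k) λ ¬wk →
      k′≢k (differ-once u∈V w∈V k′∈K k∈K uk′ ¬wk′ uk ¬wk)

    -- Otherwise `v` differs from `w` in both `k′` and `l`, which are distinct since `u` has only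
    -- the former.
    wl : R w l
    wl = decidable-stable (R? w l) λ ¬wl →
      ¬ul (subst (R u) (differ-once v∈V w∈V k′∈K l∈K vk′ ¬wk′ vl ¬wl) uk′)

    ¬zl : ¬ R z l
    ¬zl zl = l′≢l (differ-once z∈V u∈V l′∈K l∈K zl′ ¬ul′ zl ¬ul)

    ¬zk : ¬ R z k
    ¬zk zk = ¬ul′ (subst (R u) (differ-once z∈V v∈V k∈K l′∈K zk ¬vk zl′ ¬vl′) uk)

  -- The single element related to a vertex labels its part, so equal parts mean equal sets;
  -- `covers` makes every part nonempty.
  unique⇒partMap : (∀ v → v ∈ V → ∃ (Unique K (R v))) → PartMap G K
  unique⇒partMap unique with f , correct ← choice V unique = record
    { part      = f
    ; part∈K    = λ x x∈V → proj₁ (correct x x∈V)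
    ; part-onto = λ k k∈K → let u , u∈V , uk = covers k∈K in
        u , u∈V , sym (proj₂ (proj₂ (correct u u∈V)) k∈K uk)
    ; part-≢⇒~  = λ {x} {y} x∈V y∈V fx≢fy →
        let fx∈K , xfx , _ = correct x x∈V
            _ , _ , only   = correct y y∈V
        in differ⇒~ x∈V y∈V fx∈K xfx (fx≢fy ∘ only fx∈K)
    ; part-≡⇒≁  = λ {x} {y} fx≡fy x~y →
        let k , k∈K , xk , ¬yk = ~⇒differ x~y
            _ , _ , only       = correct x (~-endpoint x~y)
            _ , yfy , _        = correct y (~-endpoint (~-sym x~y))
        in ¬yk (subst (R y) (sym (trans (only k∈K xk) fx≡fy)) yfy)
    }

-- The set of one vertex settles whether all sets are singletons or all are co-singletons; in the
-- second case the missing element labels the part.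
exchange⇒partMap : {G : Graph n} {K : Subset n} {R : Fin n → Fin n → Set} →
  ExchangeFamily G K R → (∀ u → u ∈ Graph.V G → ∃[ k ] (k ∈ K × R u k)) → PartMap G K
exchange⇒partMap {G = G} F total with nonempty? (Graph.V G)
... | no empty = unique⇒partMap F λ v v∈V → contradiction (v , v∈V) empty
... | yes (u , u∈V) =
  [ (λ (_ , unique) → unique⇒partMap F (unique-spreads F u∈V unique))
  , (λ (_ , unique) → unique⇒partMap (complement F) (unique-spreads (complement F) u∈V unique))
  ] (unique-or-co-unique F u∈V (total u u∈V))

-- Induced paths and 2-switches in split graphs

module _ (G : Graph n) where
  open Graph G

  -- Distinctness follows from the adjacencies: for any two of the four vertices, some vertex is
  -- adjacent to exactly one of them.
  inducedPath : ∀ {a b c d} → a ~ b → b ~ c → c ~ d →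
    ¬ (a ~ c) → ¬ (b ~ d) → ¬ (a ~ d) →
    let f = a ∷ b ∷ c ∷ d ∷ [] in IsIsoFromP₄ (induced G (image f)) f
  inducedPath {a} {b} {c} {d} ab bc cd ¬ac ¬bd ¬ad = record
    { into      = λ i → x∈p∩q⁺ (vertex i , ∈-image⁺ f i refl)
    ; injective = injective
    ; onto      = λ x → ∈-image⁻ f ∘ proj₂ ∘ x∈p∩q⁻ V (image f)
    ; edges     = λ i j →
        [ (λ (p , q) → mk⇔ (λ _ → q , ∈-image⁺ f i refl , ∈-image⁺ f j refl) (λ _ → p))
        , (λ (¬p , ¬q) → mk⇔ (λ p → contradiction p ¬p) (λ (q , _) → contradiction q ¬q))
        ] (agree i j)
    }
    where
    module P = Graph P₄
    f = a ∷ b ∷ c ∷ d ∷ []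

    vertex : ∀ i → lookup f i ∈ V
    vertex 0F = ~-endpoint ab
    vertex 1F = ~-endpoint bc
    vertex 2F = ~-endpoint cd
    vertex 3F = ~-endpoint (~-sym cd)

    separated : ∀ {x y z} → x ~ z → ¬ (y ~ z) → x ≢ y
    separated xz ¬yz refl = ¬yz xz

    a≢b : a ≢ b
    a≢b = separated ab ~-irrefl
    a≢c : a ≢ c
    a≢c = separated cd ¬ad ∘ sym
    a≢d : a ≢ d
    a≢d = separated ab (¬bd ∘ ~-sym)
    b≢c : b ≢ c
    b≢c = separated bc ~-irrefl
    b≢d : b ≢ d
    b≢d = separated (~-sym ab) (¬ad ∘ ~-sym)
    c≢d : c ≢ d
    c≢d = separated cd ~-irrefl

    injective : ∀ i j → lookup f i ≡ lookup f j → i ≡ j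
    injective 0F 0F _ = refl
    injective 0F 1F e = contradiction e a≢b
    injective 0F 2F e = contradiction e a≢c
    injective 0F 3F e = contradiction e a≢d
    injective 1F 0F e = contradiction (sym e) a≢b
    injective 1F 1F _ = refl
    injective 1F 2F e = contradiction e b≢c
    injective 1F 3F e = contradiction e b≢d
    injective 2F 0F e = contradiction (sym e) a≢c
    injective 2F 1F e = contradiction (sym e) b≢c
    injective 2F 2F _ = refl
    injective 2F 3F e = contradiction e c≢d
    injective 3F 0F e = contradiction (sym e) a≢d
    injective 3F 1F e = contradiction (sym e) b≢d
    injective 3F 2F e = contradiction (sym e) c≢d
    injective 3F 3F _ = refl

    -- One table of common truth values yields both directions of `edges`.
    agree : ∀ i j → (i P.~ j × lookup f i ~ lookup f j)
                  ⊎ (¬ (i P.~ j) × ¬ (lookup f i ~ lookup f j))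
    agree 0F 0F = inj₂ (P.~-irrefl , ~-irrefl)
    agree 0F 1F = inj₁ (inj₁ refl , ab)
    agree 0F 2F = inj₂ (from-no (0F P.~? 2F) , ¬ac)
    agree 0F 3F = inj₂ (from-no (0F P.~? 3F) , ¬ad)
    agree 1F 0F = inj₁ (inj₂ refl , ~-sym ab)
    agree 1F 1F = inj₂ (P.~-irrefl {1F} , ~-irrefl)
    agree 1F 2F = inj₁ (inj₁ refl , bc)
    agree 1F 3F = inj₂ (from-no (1F P.~? 3F) , ¬bd)
    agree 2F 0F = inj₂ (from-no (2F P.~? 0F) , ¬ac ∘ ~-sym)
    agree 2F 1F = inj₁ (inj₂ refl , ~-sym bc)
    agree 2F 2F = inj₂ (P.~-irrefl {2F} , ~-irrefl)
    agree 2F 3F = inj₁ (inj₁ refl , cd)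
    agree 3F 0F = inj₂ (from-no (3F P.~? 0F) , ¬ad ∘ ~-sym)
    agree 3F 1F = inj₂ (from-no (3F P.~? 1F) , ¬bd ∘ ~-sym)
    agree 3F 2F = inj₁ (inj₂ refl , ~-sym cd)
    agree 3F 3F = inj₂ (P.~-irrefl {3F} , ~-irrefl)

  inducesP₄⇒1≤σ : ∀ {u v T} → InducesP₄ G u v T → 1 ≤ σ G u v
  inducesP₄⇒1≤σ {u} {v} {T} h = ∈⇒length>0 (∈-filter⁺ (inducesP₄? G u v) (∈-subsets T) h)

  1≤σ⇒inducesP₄ : ∀ {u v} → 1 ≤ σ G u v → ∃ (InducesP₄ G u v)
  1≤σ⇒inducesP₄ {u} {v} p =
    let T , T∈ = length>0⇒∃∈ (filter (inducesP₄? G u v) (subsets n)) p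
    in T , proj₂ (∈-filter⁻ (inducesP₄? G u v) {xs = subsets n} T∈)

  σ≤1⇒inducesP₄-unique : ∀ {u v T U} → σ G u v ≤ 1 →
    InducesP₄ G u v T → InducesP₄ G u v U → T ≡ U
  σ≤1⇒inducesP₄-unique {u} {v} {T} {U} p hT hU =
    length≤1⇒∈-unique (filter (inducesP₄? G u v) (subsets n)) p
      (∈-filter⁺ (inducesP₄? G u v) (∈-subsets T) hT)
      (∈-filter⁺ (inducesP₄? G u v) (∈-subsets U) hU)

module _ {A : Set} where

  when-yes : (a? : Dec A) (k : ℕ) → A → when a? k ≡ k
  when-yes (yes _) k _ = refl
  when-yes (no ¬a) k a = contradiction a ¬a

module _ (X : SplitGraph n) where
  open SplitGraph X
  open Graph S
  private
    module Φ = Graph (underlying (factorGraph X))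

  K⊆V : ∀ {x} → x ∈ K → x ∈ V
  K⊆V = subst (_ ∈_) partition ∘ x∈p∪q⁺ ∘ inj₁

  K-or-I : ∀ {x} → x ∈ V → x ∈ K ⊎ x ∈ I
  K-or-I = x∈p∪q⁻ K I ∘ subst (_ ∈_) (sym partition)

  K∩I-empty : ∀ {x} → x ∈ K → ¬ (x ∈ I)
  K∩I-empty x∈K x∈I = disjoint (_ , x∈p∩q⁺ (x∈K , x∈I))

  ~I⇒∈K : ∀ {x y} → x ∈ I → x ~ y → y ∈ K
  ~I⇒∈K x∈I x~y = [ id , (λ y∈I → contradiction x~y (proj₂ I-independent _ _ x∈I y∈I)) ]
    (K-or-I (~-endpoint (~-sym x~y)))

  ≁K⇒∈I : ∀ {x y} → x ∈ K → y ∈ V → x ≢ y → ¬ (x ~ y) → y ∈ I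
  ≁K⇒∈I x∈K y∈V x≢y x≁y = [ (λ y∈K → contradiction (proj₂ K-clique _ _ x∈K y∈K x≢y) x≁y) , id ]
    (K-or-I y∈V)

  -- The pattern of a 2-switch that is also an induced path `p₁ k₁ k₂ p₂`: the middle edge comes
  -- from the clique `K`, the non-adjacency of the ends from the independent set `I`.
  Alternating : (p₁ k₁ k₂ p₂ : Fin n) → Set
  Alternating p₁ k₁ k₂ p₂ = (p₁ ∈ I × k₁ ∈ K × k₂ ∈ K × p₂ ∈ I)
    × (p₁ ~ k₁ × p₂ ~ k₂ × ¬ (p₁ ~ k₂) × ¬ (p₂ ~ k₁))

  -- An edge has an end in `K` and a non-edge between distinct vertices has one in `I`, so the side
  -- of `a` determines the sides of the other three.
  alternating : ∀ {a b c d} → a ~ b → c ~ d → a ≢ c → b ≢ d → ¬ (a ~ c) → ¬ (b ~ d) →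
    Alternating b a d c ⊎ Alternating a b c d
  alternating ab cd a≢c b≢d ¬ac ¬bd with K-or-I (~-endpoint ab)
  ... | inj₁ a∈K =
    let c∈I = ≁K⇒∈I a∈K (~-endpoint cd) a≢c ¬ac
        d∈K = ~I⇒∈K c∈I cd
        b∈I = ≁K⇒∈I d∈K (~-endpoint (~-sym ab)) (b≢d ∘ sym) (¬bd ∘ ~-sym)
    in inj₁ ((b∈I , a∈K , d∈K , c∈I) , ~-sym ab , cd , ¬bd , ¬ac ∘ ~-sym)
  ... | inj₂ a∈I =
    let b∈K = ~I⇒∈K a∈I ab
        d∈I = ≁K⇒∈I b∈K (~-endpoint (~-sym cd)) b≢d ¬bd
        c∈K = ~I⇒∈K d∈I (~-sym cd)
    in inj₂ ((a∈I , b∈K , c∈K , d∈I) , ab , ~-sym cd , ¬ac , ¬bd ∘ ~-sym)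

  active⇒alternating : ∀ {x} → IsActiveVertex S x →
    ∃[ u ] ∃[ k ] ∃[ l ] ∃[ v ] (Alternating u k l v × (x ≡ u ⊎ x ≡ v ⊎ x ≡ k ⊎ x ≡ l))
  active⇒alternating (a , b , c , d , switch , x≡) =
    [ (λ alt → b , a , d , c , alt ,
        [ inj₂ ∘ inj₂ ∘ inj₁ , [ inj₁ , [ inj₂ ∘ inj₁ , inj₂ ∘ inj₂ ∘ inj₂ ] ] ] x≡)
    , (λ alt → a , b , c , d , alt ,
        [ inj₁ , [ inj₂ ∘ inj₂ ∘ inj₁ , [ inj₂ ∘ inj₂ ∘ inj₂ , inj₂ ∘ inj₁ ] ] ] x≡)
    ] (alternating ab∈E cd∈E a≢c b≢d ac∉E bd∉E)
    where open TwoSwitch switch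

  active-I⇒∃~ : ∀ {u} → IsActiveVertex S u → u ∈ I → ∃[ k ] (k ∈ K × u ~ k)
  active-I⇒∃~ active u∈I with active⇒alternating active
  ... | _ , k , l , _ , ((_ , k∈K , l∈K , _) , uk , vl , _) , eq with eq
  ... | inj₁ refl               = k , k∈K , uk
  ... | inj₂ (inj₁ refl)        = l , l∈K , vl
  ... | inj₂ (inj₂ (inj₁ refl)) = contradiction u∈I (K∩I-empty k∈K)
  ... | inj₂ (inj₂ (inj₂ refl)) = contradiction u∈I (K∩I-empty l∈K)

  -- Each middle vertex of an alternating path is adjacent to one end and not to the other.
  active-K⇒∃~∃≁ : ∀ {k} → IsActiveVertex S k → k ∈ K →
    (∃[ u ] (u ∈ I × u ~ k)) × (∃[ v ] (v ∈ I × ¬ (v ~ k)))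
  active-K⇒∃~∃≁ active k∈K with active⇒alternating active
  ... | u , _ , _ , v , ((u∈I , _ , _ , v∈I) , uk , vl , ¬ul , ¬vk) , eq with eq
  ... | inj₁ refl               = contradiction u∈I (K∩I-empty k∈K)
  ... | inj₂ (inj₁ refl)        = contradiction v∈I (K∩I-empty k∈K)
  ... | inj₂ (inj₂ (inj₁ refl)) = (u , u∈I , uk) , v , v∈I , ¬vk
  ... | inj₂ (inj₂ (inj₂ refl)) = (v , v∈I , vl) , u , u∈I , ¬ul

  alternating⇒inducesP₄ : ∀ {u k l v} → Alternating u k l v →
    InducesP₄ S u v (image (u ∷ k ∷ l ∷ v ∷ []))
  alternating⇒inducesP₄ {u} {k} {l} {v} ((u∈I , k∈K , l∈K , v∈I) , uk , vl , ¬ul , ¬vk) =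
    (λ x∈ → let i , eq = ∈-image⁻ f x∈ in
      subst (_∈ V) eq (proj₁ (x∈p∩q⁻ V (image f) (IsIsoFromP₄.into iso i))))
    , (∈-image⁺ f 0F refl , ∈-image⁺ f 3F refl) , f , iso
    where
    f = u ∷ k ∷ l ∷ v ∷ []
    k≢l : k ≢ l
    k≢l refl = ¬ul uk
    iso : IsIsoFromP₄ (induced S (image f)) f
    iso = inducedPath S uk (proj₂ K-clique k l k∈K l∈K k≢l) (~-sym vl)
            ¬ul (¬vk ∘ ~-sym) (proj₂ I-independent u v u∈I v∈I)

  -- In the second image `k` can only be `k′`: the ends lie in `I`, and `l` is not adjacent to `u`.
  alternating-image-injective : ∀ {u k k′ l v} →
    Alternating u k l v →
    image (u ∷ k ∷ l ∷ v ∷ []) ≡ image (u ∷ k′ ∷ l ∷ v ∷ []) → k ≡ k′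
  alternating-image-injective {u} {k} {k′} {l} {v} ((u∈I , k∈K , _ , v∈I) , uk , _ , ¬ul , _) eq
    with ∈-image⁻ (u ∷ k′ ∷ l ∷ v ∷ [])
           (subst (k ∈_) eq (∈-image⁺ (u ∷ k ∷ l ∷ v ∷ []) 1F refl))
  ... | 0F , refl = contradiction u∈I (K∩I-empty k∈K)
  ... | 1F , k′≡k = sym k′≡k
  ... | 2F , refl = contradiction uk ¬ul
  ... | 3F , refl = contradiction v∈I (K∩I-empty k∈K)

  -- The two end edges of the path form a 2-switch. Its other orientation would put the adjacent
  -- vertices `b` and `c` into `I`.
  isoFromP₄⇒alternating : ∀ {a b c d T} →
    IsIsoFromP₄ (induced S T) (a ∷ b ∷ c ∷ d ∷ []) → Alternating a b c d
  isoFromP₄⇒alternating {a} {b} {c} {d} {T} iso =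
    [ id
    , (λ { ((b∈I , _ , _ , c∈I) , _) → contradiction bc (proj₂ I-independent b c b∈I c∈I) })
    ] (alternating (~-sym ab) (~-sym cd) b≢d a≢c ¬bd ¬ac)
    where
    open IsIsoFromP₄ iso
    module P = Graph P₄
    f = a ∷ b ∷ c ∷ d ∷ []
    edge : ∀ i j → i P.~ j → lookup f i ~ lookup f j
    edge i j = proj₁ ∘ Equivalence.to (edges i j)
    non-edge : ∀ i j → ¬ (i P.~ j) → ¬ (lookup f i ~ lookup f j)
    non-edge i j ¬p q = ¬p (Equivalence.from (edges i j) (q , ∈T i , ∈T j))
      where
      ∈T : ∀ i → lookup f i ∈ T
      ∈T i = proj₂ (x∈p∩q⁻ V T (into i))
    ab = edge 0F 1F (inj₁ refl)
    bc = edge 1F 2F (inj₁ refl)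
    cd = edge 2F 3F (inj₁ refl)
    ¬ac = non-edge 0F 2F (from-no (0F P.~? 2F))
    ¬bd = non-edge 1F 3F (from-no (1F P.~? 3F))
    a≢c : a ≢ c
    a≢c eq = case injective 0F 2F eq of λ ()
    b≢d : b ≢ d
    b≢d eq = case injective 1F 3F eq of λ ()

  -- Only the ends of the path lie in `I`, so they are `u` and `v`, and the neighbour of `u` on the
  -- path is the witness.
  inducesP₄⇒∃~≁ : ∀ {u v T} → u ∈ I → v ∈ I → u ≢ v → InducesP₄ S u v T →
    ∃[ k ] (k ∈ K × u ~ k × ¬ (v ~ k))
  inducesP₄⇒∃~≁ {u} {v} {T} u∈I v∈I u≢v (T⊆V , (u∈T , v∈T) , f@(a ∷ b ∷ c ∷ d ∷ []) , iso)
    with (a∈I , b∈K , c∈K , d∈I) , ab , dc , ¬ac , ¬db ← isoFromP₄⇒alternating iso =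
    cases (end u∈I u∈T) (end v∈I v∈T)
    where
    end : ∀ {x} → x ∈ I → x ∈ T → a ≡ x ⊎ d ≡ x
    end x∈I x∈T with IsIsoFromP₄.onto iso _ (x∈p∩q⁺ (T⊆V x∈T , x∈T))
    ... | 0F , eq   = inj₁ eq
    ... | 1F , refl = contradiction x∈I (K∩I-empty b∈K)
    ... | 2F , refl = contradiction x∈I (K∩I-empty c∈K)
    ... | 3F , eq   = inj₂ eq

    cases : a ≡ u ⊎ d ≡ u → a ≡ v ⊎ d ≡ v → ∃[ k ] (k ∈ K × u ~ k × ¬ (v ~ k))
    cases (inj₁ refl) (inj₁ refl) = contradiction refl u≢v
    cases (inj₁ refl) (inj₂ refl) = b , b∈K , ab , ¬db
    cases (inj₂ refl) (inj₁ refl) = c , c∈K , dc , ¬ac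
    cases (inj₂ refl) (inj₂ refl) = contradiction refl u≢v

  -- The factor graph

  private
    mult : Fin n → Fin n → ℕ
    mult = Multigraph.mult (factorGraph X)

  mult≡σ : ∀ {u v} → u ≢ v → u ∈ I → v ∈ I → mult u v ≡ σ S u v
  mult≡σ {u} {v} u≢v u∈I v∈I = when-yes (distinct∈? I u v) (σ S u v) (u≢v , u∈I , v∈I)

  Φ~⇒distinct : ∀ {u v} → u Φ.~ v → Distinct∈ I u v
  Φ~⇒distinct {u} {v} = when-positive (distinct∈? I u v) (σ S u v)

  Φ~⇒∃~≁ : ∀ {u v} → u Φ.~ v → ∃[ k ] (k ∈ K × u ~ k × ¬ (v ~ k))
  Φ~⇒∃~≁ {u} {v} u~v =
    let u≢v , u∈I , v∈I = Φ~⇒distinct {u} {v} u~v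
        T , path = 1≤σ⇒inducesP₄ S (subst (1 ≤_) (mult≡σ u≢v u∈I v∈I) u~v)
    in inducesP₄⇒∃~≁ u∈I v∈I u≢v path

  alternating⇒Φ~ : ∀ {u k l v} → Alternating u k l v → u Φ.~ v
  alternating⇒Φ~ alt@((u∈I , _ , _ , v∈I) , uk , _ , _ , ¬vk) =
    subst (1 ≤_) (sym (mult≡σ (λ { refl → ¬vk uk }) u∈I v∈I))
      (inducesP₄⇒1≤σ S (alternating⇒inducesP₄ alt))

  module _ (simple : IsSimple (factorGraph X)) where

    σ≤1 : ∀ {u v} → u ≢ v → u ∈ I → v ∈ I → σ S u v ≤ 1
    σ≤1 {u} {v} u≢v u∈I v∈I = subst (_≤ 1) (mult≡σ u≢v u∈I v∈I)
      ([ (λ eq → subst (_≤ 1) (sym eq) z≤n) , ℕ.≤-reflexive ] (simple u v))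

    -- Different `k` and `k′` would give two vertex sets inducing a `P₄` through `u` and `v`,
    -- against simplicity.
    alternating-unique : ∀ {u k k′ l v} → Alternating u k l v → Alternating u k′ l v → k ≡ k′
    alternating-unique {u} {v = v} alt@((u∈I , _ , _ , v∈I) , uk , _ , _ , ¬vk) alt′ =
      alternating-image-injective alt (σ≤1⇒inducesP₄-unique S
        (σ≤1 {u} {v} (λ { refl → ¬vk uk }) u∈I v∈I)
        (alternating⇒inducesP₄ alt) (alternating⇒inducesP₄ alt′))

    private
      N : Fin n → Subset n
      N = neighbours S

      ∈N⁺ : ∀ {u x} → u ~ x → x ∈ N u
      ∈N⁺ {u} = ∈-tabulate-does⁺ (u ~?_)

      ∈N⁻ : ∀ {u x} → x ∈ N u → u ~ x
      ∈N⁻ {u} = ∈-tabulate-does⁻ (u ~?_)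

    -- With `l` fixed, every element of `N u` outside `N v` completes an alternating path and so
    -- equals `k`, while `N v` gains `l`.
    Φ~⇒∣N∣≤∣N∣ : ∀ {u v} → u Φ.~ v → ∣ N u ∣ ≤ ∣ N v ∣
    Φ~⇒∣N∣≤∣N∣ {u} {v} u~v =
      let _ , u∈I , v∈I      = Φ~⇒distinct {u} {v} u~v
          k , k∈K , uk , ¬vk = Φ~⇒∃~≁ {u} {v} u~v
          l , l∈K , vl , ¬ul = Φ~⇒∃~≁ {v} {u} (Φ.~-sym {u} {v} u~v)
      in exchange⇒∣p∣≤∣q∣ {x = k} {l}
           (λ x∈ x∉ → let ux = ∈N⁻ x∈ in alternating-unique
             ((u∈I , ~I⇒∈K u∈I ux , l∈K , v∈I) , ux , vl , ¬ul , x∉ ∘ ∈N⁺)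
             ((u∈I , k∈K , l∈K , v∈I) , uk , vl , ¬ul , ¬vk))
           (∈N⁺ vl) (¬ul ∘ ∈N⁻)

    connected⇒∣N∣≤∣N∣ : ∀ {u v} → Star Φ._~_ u v → ∣ N u ∣ ≤ ∣ N v ∣
    connected⇒∣N∣≤∣N∣ ε = ℕ.≤-refl
    connected⇒∣N∣≤∣N∣ (_◅_ {i = u} {j = w} e p) =
      ℕ.≤-trans (Φ~⇒∣N∣≤∣N∣ {u} {w} e) (connected⇒∣N∣≤∣N∣ p)

    module _ (connected : IsConnected (underlying (factorGraph X))) where

      -- Connectedness makes all neighbourhoods equally large, so the element `k` lost from `N u` is
      -- compensated by some `l` in `N v`.
      ~≁⇒alternating : ∀ {u v k} → u ∈ I → v ∈ I → u ~ k → ¬ (v ~ k) →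
        ∃[ l ] Alternating u k l v
      ~≁⇒alternating {u} {v} u∈I v∈I uk ¬vk =
        let l , vl , ul∉ = ∣p∣≤∣q∣-exchange
              (connected⇒∣N∣≤∣N∣ (connected u v u∈I v∈I)) (∈N⁺ uk) (¬vk ∘ ∈N⁻)
        in l , (u∈I , ~I⇒∈K u∈I uk , ~I⇒∈K v∈I (∈N⁻ vl) , v∈I)
             , uk , ∈N⁻ vl , ul∉ ∘ ∈N⁺ , ¬vk

      exchangeFamily : IsActive S → ExchangeFamily (underlying (factorGraph X)) K _~_
      exchangeFamily active = record
        { R?          = _~?_
        ; covers      = λ k∈K → proj₁ (active-K⇒∃~∃≁ (active _ (K⊆V k∈K)) k∈K)
        ; misses      = λ k∈K → proj₂ (active-K⇒∃~∃≁ (active _ (K⊆V k∈K)) k∈K)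
        ; exchange    = λ u∈I v∈I _ uk ¬vk →
            let l , (_ , _ , l∈K , _) , _ , vl , ¬ul , _ = ~≁⇒alternating u∈I v∈I uk ¬vk
            in l , l∈K , vl , ¬ul
        ; differ-once = λ u∈I v∈I k∈K k′∈K uk ¬vk uk′ ¬vk′ →
            -- The `l` found for `k` also completes a path through `k′`, so the two paths can be
            -- compared.
            let l , alt@((_ , _ , l∈K , _) , _ , vl , ¬ul , _) = ~≁⇒alternating u∈I v∈I uk ¬vk
            in alternating-unique alt ((u∈I , k′∈K , l∈K , v∈I) , uk′ , vl , ¬ul , ¬vk′)
        ; differ⇒~    = λ {u} {v} u∈I v∈I _ uk ¬vk →
            let _ , alt = ~≁⇒alternating {u} {v} u∈I v∈I uk ¬vk in alternating⇒Φ~ alt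
        ; ~⇒differ    = λ {u} {v} → Φ~⇒∃~≁ {u} {v}
        }

theorem5p2 : ∀ (n : ℕ) (X : SplitGraph n) →
    let open SplitGraph X
        Φ = underlying (factorGraph X)
    in IsActive S →
       IsSimple (factorGraph X) →
       IsConnected Φ →
       ExactlyOne
         (IsComplete Φ × ∣ K ∣ ≡ ∣ I ∣)
         (∣ K ∣ ≡ cliqueNumber Φ × ∣ K ∣ < ∣ I ∣
           × (∀ v → v ∈ I → ∃[ C ] (IsMaximumClique Φ C × v ∈ C))
           × ∣ K ∣ ≤ 1 + minDegree Φ)
theorem5p2 n X active simple connected =
  CompleteMultipartite.dichotomy (exchange⇒partMap
    (exchangeFamily X simple connected active)
    -- Activity in `I` rules out empty neighbourhoods.
    λ u u∈I → active-I⇒∃~ X (active u (proj₁ I-independent u∈I)) u∈I)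
  where open SplitGraph X
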